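{- Let $K$ be a finite extension of $\mathbb{Q}_p$, let $n\ge 1$, and let $P$ and $P'$ be potential ramification polygons of degree $n$ over $K$ (as defined in the context) such that every vertex of $P'$ is a vertex of $P$. If $P$ is weakly valid, then $P'$ is weakly valid. In particular, if $P$ is valid (i.e. it is the ramification polygon of some monic Eisenstein polynomial of degree $n$ over $K$), then $P'$ is weakly valid.
   Context: Fix a uniformizer $\pi$ of $K$ and let $v$ be the valuation on $\bar K$ with $v(\pi)=1$. For integers $i\ge j\ge 0$ put $B(i,j)=v\binom{i}{j}$. Ramification polygon: for a monic Eisenstein polynomial $f(x)=\sum_{i=0}^n f_ix^i\in K[x]$ of degree $n$ with a root $\alpha$, the ramification polynomial is $r(x)=\alpha^{ -n}f(\alpha x+\alpha)=\sum_{j=1}^n r_jx^j$, and its ramification polygon is the lower convex hull of the points $(j,\,n\,v(r_j))$, $1\le j\le n$, $r_j\neq 0$ (the Newton polygon of $r$ with valuations scaled by $n$). Its interior vertices have first coordinates powers of $p$ and it has a vertex at $(p^{v_p(n)},0)$ and ends at $(n,0)$. Potential ramification polygon: a convex polygon given by its vertex list $P=[(p^{s_0},J_0),(p^{s_1},J_1),\ldots,(p^{s_u},J_u),(n,0)]$ with integers $0\le s_0<s_1<\dots<s_u=v_p(n)$, integers $J_0>J_1>\dots>J_u=0$. It is called valid (over $K$) if it is the ramification polygon of some monic Eisenstein polynomial of degree $n$ in $K[x]$. For each vertex write $J_t=a_tn+b_t$ with integers $a_t$ and $1\le b_t\le n$, and for an integer $i$ define $\ell_P(i,s_t)=a_t+\left\lceil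 \frac{b_t-i}{n}\right\rceil-B(i,p^{s_t})+1$. $P$ is weakly valid if all of the following hold (with $t,r$ ranging over $0,\dots,u$): (1) $p^{s_t}\le b_t$ for all $t$; (2) (Ore 1) if $b_t=n$ then $\ell_P(n,s_t)=0$; (3) (Ore 2) $\ell_P(n,s_t)\le 0$ for all $t$; (4) (Ore 3) if $b_t<n$ then $\ell_P(b_t,s_t)\ge 1$; (5) (Consistency) if $b_r=b_t<n$ then $\ell_P(b_t,s_t)=\ell_P(b_r,s_r)$; (6) (Bounding) if $p^{s_r}\le b_t<n$ then $\ell_P(b_t,s_t)\ge \ell_P(b_t,s_r)$. -}

module Defs where

open import Data.Nat as ℕ using (ℕ; zero; suc; _+_; _*_; _∸_; _^_; NonZero)
open import Data.Nat.Combinatorics using (_C_)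
open import Data.Integer as ℤ using (ℤ; +_; -_; _/ℕ_; 0ℤ; 1ℤ)
open import Data.Product using (_×_; _,_; ∃-syntax)
open import Data.List using (List; []; _∷_; _++_; [_]; map)
open import Data.List.Membership.Propositional using (_∈_)
open import Data.List.Relation.Unary.Linked using (Linked)
open import Data.Unit using (⊤)
open import Relation.Binary.PropositionalEquality using (_≡_)

-- p-adic valuation of a natural number (computed with fuel).
-- vp p m is the exponent of p in m, for p ≥ 2 and m ≥ 1
-- (junk value 0 when p < 2 or m = 0; never used in those cases).

vpFuel : ℕ → ℕ → ℕ → ℕ
vpFuel zero    p                 m       = 0
vpFuel (suc k) zero              m       = 0
vpFuel (suc k) (suc zero)        m       = 0
vpFuel (suc k) (suc (suc q))     zero    = 0
vpFuel (suc k) (suc (suc q)) (suc m) with suc m ℕ.% suc (suc q)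
... | zero  = suc (vpFuel k (suc (suc q)) (suc m ℕ./ suc (suc q)))
... | suc _ = 0

vp : ℕ → ℕ → ℕ
vp p m = vpFuel m p m

-- K is a finite extension of Q_p with ramification index e; the
-- normalized valuation v (v(π) = 1) restricted to ℤ is e · v_p.
-- B(i,j) = v (i choose j).

B : (e p i j : ℕ) → ℕ
B e p i j = e * vp p (i C j)

-- A potential ramification polygon of degree n is given by the list
-- [(s_0,J_0), …, (s_u,J_u)] of pairs (s_t, J_t) encoding the vertices
-- (p^{s_t}, J_t); the final vertex (n,0) is implicit.

Polygon : Set
Polygon = List (ℕ × ℕ)

vertices : (p n : ℕ) → Polygon → List (ℕ × ℕ)
vertices p n P = map (λ { (s , J) → (p ^ s , J) }) P ++ [ (n , 0) ]

-- strict convexity at consecutive vertices x, y, z: the slope of the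
-- segment x–y is strictly less than the slope of y–z; all slopes are
-- negative here, so this is
--   (J_x - J_y)/(p^{s_y} - p^{s_x}) > (J_y - J_z)/(p^{s_z} - p^{s_y}).
ConvexAt : ℕ → (ℕ × ℕ) → (ℕ × ℕ) → (ℕ × ℕ) → Set
ConvexAt p (sx , Jx) (sy , Jy) (sz , Jz) =
  (Jy ∸ Jz) * (p ^ sy ∸ p ^ sx) ℕ.< (Jx ∸ Jy) * (p ^ sz ∸ p ^ sy)

Convex : ℕ → Polygon → Set
Convex p (x ∷ y ∷ z ∷ rest) = ConvexAt p x y z × Convex p (y ∷ z ∷ rest)
Convex p _                  = ⊤

Step : (ℕ × ℕ) → (ℕ × ℕ) → Set
Step (s , J) (s' , J') = s ℕ.< s' × J' ℕ.< J

record IsPotentialRamificationPolygon (p n : ℕ) (P : Polygon) : Set where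
  field
    ends-at     : ∃[ Q ] P ≡ Q ++ [ (vp p n , 0) ]
    monotone    : Linked Step P
    convex      : Convex p P

-- J = a n + b with 1 ≤ b ≤ n

aOf : (n J : ℕ) → .{{NonZero n}} → ℤ
aOf n J = + ((J + n ∸ 1) ℕ./ n) ℤ.- 1ℤ

bOf : (n J : ℕ) → .{{NonZero n}} → ℕ
bOf n J = suc ((J + n ∸ 1) ℕ.% n)

ceilDiv : ℤ → (n : ℕ) → .{{NonZero n}} → ℤ
ceilDiv x n = - ((- x) /ℕ n)

ell : (e p n : ℕ) → .{{NonZero n}} → (s J i : ℕ) → ℤ
ell e p n s J i =
  aOf n J ℤ.+ ceilDiv (+ bOf n J ℤ.- + i) n ℤ.- + B e p i (p ^ s) ℤ.+ 1ℤ

record WeaklyValid (e p n : ℕ) .{{_ : NonZero n}} (P : Polygon) : Set where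
  field
    cond1 : ∀ {s J} → (s , J) ∈ P → p ^ s ℕ.≤ bOf n J
    ore1  : ∀ {s J} → (s , J) ∈ P → bOf n J ≡ n → ell e p n s J n ≡ 0ℤ
    ore2  : ∀ {s J} → (s , J) ∈ P → ell e p n s J n ℤ.≤ 0ℤ
    ore3  : ∀ {s J} → (s , J) ∈ P → bOf n J ℕ.< n →
              1ℤ ℤ.≤ ell e p n s J (bOf n J)
    consistency : ∀ {s J s' J'} → (s , J) ∈ P → (s' , J') ∈ P →
              bOf n J' ≡ bOf n J → bOf n J ℕ.< n →
              ell e p n s J (bOf n J) ≡ ell e p n s' J' (bOf n J')
    bounding : ∀ {s J s' J'} → (s , J) ∈ P → (s' , J') ∈ P →
              p ^ s' ℕ.≤ bOf n J → bOf n J ℕ.< n →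
              ell e p n s' J' (bOf n J) ℤ.≤ ell e p n s J (bOf n J)

module Submission where

-- Every condition in the definition of weak validity is a
-- statement quantified over the vertices of the polygon (single vertices
-- for (1)-(4), pairs of vertices for (5)-(6)).  Hence weak validity is
-- inherited by any polygon whose vertex data (s_t , J_t) all occur in P
-- (`weaklyValid-⊆`).  It therefore suffices to show that the hypothesis
-- "every vertex (p^s , J) of P' is a vertex of P" forces every pair
-- (s , J) of P' to be a pair of P (`vertices-⊆⇒⊆`):
--   * if (p^s , J) comes from a pair (s₂ , J₂) of P, then s = s₂ because
--     s ↦ p^s is injective for p > 1 (`toPoint-injective`);
--   * if (p^s , J) is the implicit end point (n , 0), then J = 0, and since
--     the heights J_t strictly decrease, the only pair of P' of height 0 is
--     its last one (v_p(n) , 0) (`height-zero⇒last`), which is also the last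
--     pair of P.

open import Defs
open import Data.Nat using (ℕ; _≤_; NonZero)
open import Data.Nat.Primality using (Prime)
open import Data.Product using (_×_)
open import Data.List.Membership.Propositional using (_∈_)

import Data.Nat as N
open import Data.Nat.Properties using (^-monoʳ-<; <-cmp; <-irrefl; <-trans; n≮0)
open import Data.Nat.Primality using (prime⇒nonTrivial)
open import Data.Product using (_,_; proj₂)
open import Data.Product.Properties using (,-injectiveˡ; ,-injectiveʳ)
open import Data.Sum using (inj₁; inj₂)
open import Data.List using ([]; _∷_; _++_; [_]; map)
open import Data.List.Relation.Unary.Any using (here; there)
open import Data.List.Relation.Unary.Linked using (Linked; _∷_)
open import Data.List.Relation.Binary.Subset.Propositional using (_⊆_)
open import Data.List.Membership.Propositional.Properties
  using (∈-map⁺; ∈-map⁻; ∈-++⁺ˡ; ∈-++⁺ʳ; ∈-++⁻)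
open import Function.Definitions using (Injective)
open import Relation.Binary.PropositionalEquality using (_≡_; refl; sym; cong₂; subst)
open import Relation.Binary.Definitions using (tri<; tri≈; tri>)
open import Data.Empty using (⊥-elim)

weaklyValid-⊆ : ∀ {e p n} .{{_ : NonZero n}} {P P' : Polygon} →
  P' ⊆ P → WeaklyValid e p n P → WeaklyValid e p n P'
weaklyValid-⊆ P'⊆P wv = record
  { cond1       = λ v → cond1 (P'⊆P v)
  ; ore1        = λ v → ore1 (P'⊆P v)
  ; ore2        = λ v → ore2 (P'⊆P v)
  ; ore3        = λ v → ore3 (P'⊆P v)
  ; consistency = λ v v' → consistency (P'⊆P v) (P'⊆P v')
  ; bounding    = λ v v' → bounding (P'⊆P v) (P'⊆P v')
  }
  where open WeaklyValid wv

∈-map-injective : ∀ {A B : Set} {f : A → B} → Injective _≡_ _≡_ f →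
  ∀ {x xs} → f x ∈ map f xs → x ∈ xs
∈-map-injective f-inj fx∈ with ∈-map⁻ _ fx∈
... | y , y∈xs , fx≡fy = subst (_∈ _) (sym (f-inj fx≡fy)) y∈xs

^-injectiveʳ : ∀ p → 1 N.< p → Injective _≡_ _≡_ (p N.^_)
^-injectiveʳ p 1<p {a} {b} pᵃ≡pᵇ with <-cmp a b
... | tri< a<b _ _ = ⊥-elim (<-irrefl pᵃ≡pᵇ (^-monoʳ-< p 1<p a<b))
... | tri≈ _ a≡b _ = a≡b
... | tri> _ _ b<a = ⊥-elim (<-irrefl (sym pᵃ≡pᵇ) (^-monoʳ-< p 1<p b<a))

toPoint : ℕ → ℕ × ℕ → ℕ × ℕ
toPoint p (s , J) = (p N.^ s , J)

toPoint-injective : ∀ p → 1 N.< p → Injective _≡_ _≡_ (toPoint p)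
toPoint-injective p 1<p eq =
  cong₂ _,_ (^-injectiveʳ p 1<p (,-injectiveˡ eq)) (,-injectiveʳ eq)

above-last : ∀ {x y} Q → Linked Step (Q ++ [ x ]) → y ∈ Q → proj₂ x N.< proj₂ y
above-last (_ ∷ [])    (step ∷ _)    (here refl) = proj₂ step
above-last (_ ∷ _ ∷ Q) (step ∷ rest) (here refl) =
  <-trans (above-last (_ ∷ Q) rest (here refl)) (proj₂ step)
above-last (_ ∷ [])    (_ ∷ _)       (there ())
above-last (_ ∷ _ ∷ Q) (_ ∷ rest)    (there y∈Q) = above-last (_ ∷ Q) rest y∈Q

height-zero⇒last : ∀ {p n s} {P : Polygon} → IsPotentialRamificationPolygon p n P →
  (s , 0) ∈ P → s ≡ vp p n
height-zero⇒last hP s0∈P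
  with IsPotentialRamificationPolygon.ends-at hP | IsPotentialRamificationPolygon.monotone hP
... | Q , refl | mono with ∈-++⁻ Q s0∈P
...   | inj₁ s0∈Q = ⊥-elim (n≮0 (above-last Q mono s0∈Q))
...   | inj₂ (here s0≡last) = ,-injectiveˡ s0≡last

last∈ : ∀ {p n} {P : Polygon} → IsPotentialRamificationPolygon p n P →
  (vp p n , 0) ∈ P
last∈ hP with IsPotentialRamificationPolygon.ends-at hP
... | Q , refl = ∈-++⁺ʳ Q (here refl)

vertices-⊆⇒⊆ : ∀ {p n} {P P' : Polygon} → 1 N.< p →
  IsPotentialRamificationPolygon p n P → IsPotentialRamificationPolygon p n P' →
  (∀ {x} → x ∈ vertices p n P' → x ∈ vertices p n P) → P' ⊆ P
vertices-⊆⇒⊆ {p} {n} {P} 1<p hP hP' sub {s , J} sJ∈P'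
  with ∈-++⁻ (map (toPoint p) P) (sub (∈-++⁺ˡ (∈-map⁺ (toPoint p) sJ∈P')))
... | inj₁ point∈P = ∈-map-injective (toPoint-injective p 1<p) point∈P
... | inj₂ (here refl) =
  subst (λ s → (s , 0) ∈ P) (sym (height-zero⇒last hP' sJ∈P')) (last∈ hP)

mainTheorem1 : (p : ℕ) → Prime p → (e : ℕ) → 1 ≤ e →
    (n : ℕ) → .{{_ : NonZero n}} → (P P' : Polygon) →
    IsPotentialRamificationPolygon p n P →
    IsPotentialRamificationPolygon p n P' →
    (∀ {x} → x ∈ vertices p n P' → x ∈ vertices p n P) →
    WeaklyValid e p n P → WeaklyValid e p n P'
mainTheorem1 p p-prime e _ n P P' hP hP' sub =
  weaklyValid-⊆ (vertices-⊆⇒⊆ 1<p hP hP' sub)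
  where
  1<p : 1 N.< p
  1<p = N.nonTrivial⇒n>1 p {{prime⇒nonTrivial p-prime}}
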